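{- Let $\|\cdot\|_X$ be a norm on $\mathbb{R}^k$, $\|\cdot\|_Y$ a norm on $\mathbb{R}^n$, and suppose that $(\mathbb{R}^k,\|\cdot\|_X)$ embeds into $(\mathbb{R}^n,\|\cdot\|_Y)$ with distortion $\alpha$. Then for any $\varepsilon,\delta$, $$\mathcal{R}_{\varepsilon,\delta}(\mathrm{IP}_X)\le\mathcal{R}_{\alpha^{ -1}\varepsilon,\delta}(\mathrm{IP}_Y)\quad\text{and}\quad \mathcal{R}^{\to}_{\varepsilon,\delta}(\mathrm{IP}_X)\le\mathcal{R}^{\to}_{\alpha^{ -1}\varepsilon,\delta}(\mathrm{IP}_Y).$$
   Context: A normed space $(X,\|\cdot\|_X)$ embeds into $(Y,\|\cdot\|_Y)$ with distortion $D$ if there is a linear map $i:X\to Y$ with $\|i(x)\|_Y\le\|x\|_X\le D\|i(x)\|_Y$ for all $x\in X$. For a norm $N$ on $\mathbb{R}^n$ the dual norm is $\|w\|_{N^*}=\sup_{\|v\|_N\le 1}\langle v,w\rangle$. In the communication problem $\mathrm{IP}_N$, Alice holds $v\in\mathbb{R}^n$ with $\|v\|_N\le1$ and Bob holds $w\in\mathbb{R}^n$ with $\|w\|_{N^*}\le1$. A private-coin protocol lets the parties, each using its own independent randomness, exchange bits; at the end Bob outputs a real number. The cost is the maximum number of bits exchanged over all inputs and coin outcomes. $\mathcal{R}_{\varepsilon,\delta}(\mathrm{IP}_N)$ is the smallest cost of a private-coin protocol (interaction in both directions allowed) such that for all valid $(v,w)$ the output is within $\varepsilon$ of $\langle v,w\rangle$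 with probability at least $1-\delta$. $\mathcal{R}^{\to}_{\varepsilon,\delta}(\mathrm{IP}_N)$ is the same quantity restricted to one-way protocols, in which Alice sends a single message to Bob, who then outputs the answer. -}

module Defs where

open import Level using (0ℓ; suc)
open import Algebra.Bundles using (CommutativeRing)
open import Algebra.Module.Bundles.Raw using (RawLeftModule)
open import Algebra.Module.Morphism.Structures using (module LeftModuleMorphisms)
open import Axiom.ExcludedMiddle using (ExcludedMiddle)
open import Data.Bool.Base using (Bool; true)
open import Data.Empty using (⊥)
open import Data.Fin.Base using (toℕ)
open import Data.Nat.Base as ℕ using (ℕ)
import Data.Nat.Induction as ℕ
import Data.Nat.Properties as ℕ
open import Data.Product.Base using (∃; ∃-syntax; Σ-syntax; _×_; _,_; proj₁)
open import Data.Unit.Base using (⊤)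
open import Data.Vec.Functional using (Vector; map; zipWith; replicate)
import Data.Vec.Functional.Relation.Binary.Equality.Setoid as VecEquality
open import Relation.Binary.Bundles using (Setoid; TotalOrder)
import Relation.Binary.Construct.On as On
import Relation.Binary.Construct.NonStrictToStrict as NonStrictToStrict
import Relation.Binary.Construct.Add.Supremum.NonStrict as AddSupremum
open import Relation.Binary.Core using (Rel)
open import Relation.Binary.PropositionalEquality.Core using (_≡_; _≢_)
open import Relation.Binary.Structures using (IsTotalOrder)
open import Relation.Nullary using (¬_; yes; no)
open import Relation.Nullary.Construct.Add.Supremum using (_⁺; ⊤⁺; [_])
open import Relation.Unary using (Pred; U; ∁; ⋃; _∩_; Empty; _≐_; _⟨×⟩_)
import Algebra.Construct.NaturalChoice.Max as Max
import Algebra.Properties.CommutativeMonoid.Sum as Sum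

-- The real numbers, given by the axioms that characterise them up to
-- isomorphism.  Equality is the setoid equality _≈_ of the ring.
record CompleteOrderedField : Set₁ where
  infix  4 _≤_
  infix  8 _⁻¹
  field
    commutativeRing : CommutativeRing 0ℓ 0ℓ

  open CommutativeRing commutativeRing public

  field
    _≤_          : Rel Carrier 0ℓ
    isTotalOrder : IsTotalOrder _≈_ _≤_
    +-monoˡ-≤    : ∀ z {x y} → x ≤ y → x + z ≤ y + z
    *-nonNeg     : ∀ {x y} → 0# ≤ x → 0# ≤ y → 0# ≤ x * y
    0≉1          : ¬ 0# ≈ 1#
    -- The value at 0# is unconstrained.
    _⁻¹          : Carrier → Carrier
    ⁻¹-cong      : ∀ {x y} → x ≈ y → x ⁻¹ ≈ y ⁻¹
    *-inverseʳ   : ∀ {x} → ¬ x ≈ 0# → x * x ⁻¹ ≈ 1#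

  IsUpperBound : Pred Carrier 0ℓ → Pred Carrier 0ℓ
  IsUpperBound P b = ∀ x → P x → x ≤ b

  IsSup : Pred Carrier 0ℓ → Pred Carrier 0ℓ
  IsSup P s = IsUpperBound P s × (∀ b → IsUpperBound P b → s ≤ b)

  field
    complete : ∀ (P : Pred Carrier 0ℓ) → ∃ P → ∃ (IsUpperBound P) → ∃ (IsSup P)

  totalOrder : TotalOrder 0ℓ 0ℓ 0ℓ
  totalOrder = record { isTotalOrder = isTotalOrder }

  open NonStrictToStrict _≈_ _≤_ public using (_<_)
  open Max totalOrder public using (_⊔_)
  open Sum +-commutativeMonoid public using (sum)

  ∣_∣ : Carrier → Carrier
  ∣ x ∣ = x ⊔ - x

-- Data.Nat's order extended by a top element: costs live in ℕ ∪ {∞}.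
open AddSupremum ℕ._≤_ public using (_≤⁺_)

least : ExcludedMiddle (suc 0ℓ) → (P : Pred ℕ (suc 0ℓ)) →
        ∃ P → ∃[ m ] (P m × (∀ k → P k → m ℕ.≤ k))
least em P (n , Pn) = ℕ.<-rec Goal step n Pn
  where
  Goal : ℕ → Set₁
  Goal n = P n → ∃[ m ] (P m × (∀ k → P k → m ℕ.≤ k))

  step : ∀ n → (∀ {k} → k ℕ.< n → Goal k) → Goal n
  step n rec Pn with em {∃[ k ] (k ℕ.< n × P k)}
  ... | yes (k , k<n , Pk) = rec k<n Pk
  ... | no  none = n , Pn , λ k Pk → ℕ.≮⇒≥ λ k<n → none (k , k<n , Pk)

-- The infimum in ℕ ∪ {∞}; the empty set has infimum ∞.
minimum : ExcludedMiddle (suc 0ℓ) → Pred ℕ (suc 0ℓ) → ℕ ⁺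
minimum em P with em {∃ P}
... | yes inhabited = [ proj₁ (least em P inhabited) ]
... | no  _         = ⊤⁺

module Spaces (ℝ : CompleteOrderedField) where

  open CompleteOrderedField ℝ renaming (Carrier to R)
  open VecEquality setoid public using (_≋_; ≋-setoid)

  ℝ^ : ℕ → RawLeftModule R 0ℓ 0ℓ
  ℝ^ n = record
    { Carrierᴹ = Vector R n
    ; _≈ᴹ_     = _≋_
    ; _+ᴹ_     = zipWith _+_
    ; _*ₗ_     = λ a → map (a *_)
    ; 0ᴹ       = replicate n 0#
    ; -ᴹ_      = map (-_)
    }

  IsLinear : ∀ {k n} → (Vector R k → Vector R n) → Set
  IsLinear {k} {n} = LeftModuleMorphisms.IsLeftModuleHomomorphism (ℝ^ k) (ℝ^ n)

  ⟨_,_⟩ : ∀ {n} → Vector R n → Vector R n → R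
  ⟨ v , w ⟩ = sum (zipWith _*_ v w)

  record Norm (n : ℕ) : Set where
    open RawLeftModule (ℝ^ n)
    field
      ‖_‖         : Vector R n → R
      ‖‖-cong     : ∀ {v w} → v ≋ w → ‖ v ‖ ≈ ‖ w ‖
      nonNeg      : ∀ v → 0# ≤ ‖ v ‖
      definite    : ∀ {v} → ‖ v ‖ ≈ 0# → v ≋ 0ᴹ
      homogeneous : ∀ a v → ‖ a *ₗ v ‖ ≈ ∣ a ∣ * ‖ v ‖
      triangle    : ∀ v w → ‖ v +ᴹ w ‖ ≤ ‖ v ‖ + ‖ w ‖

  -- "s is the dual norm of w".
  IsDualNorm : ∀ {n} → Norm n → Vector R n → R → Set
  IsDualNorm {n} N w = IsSup λ r → Σ[ v ∈ Vector R n ] (‖ v ‖ ≤ 1# × r ≈ ⟨ v , w ⟩)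
    where open Norm N

  Ball : ∀ {n} → Norm n → Setoid 0ℓ 0ℓ
  Ball {n} N = On.setoid {B = Σ[ v ∈ Vector R n ] ‖ v ‖ ≤ 1#} (≋-setoid n) proj₁
    where open Norm N

  DualBall : ∀ {n} → Norm n → Setoid 0ℓ 0ℓ
  DualBall {n} N =
    On.setoid {B = Σ[ w ∈ Vector R n ] ∃[ s ] (IsDualNorm N w s × s ≤ 1#)} (≋-setoid n) proj₁

  Embeds : ∀ {k n} → Norm k → Norm n → R → Set
  Embeds {k} {n} X Y D =
    Σ[ i ∈ (Vector R k → Vector R n) ]
      (IsLinear i × (∀ x → ‖ i x ‖Y ≤ ‖ x ‖X × ‖ x ‖X ≤ D * ‖ i x ‖Y))
    where
    open Norm X using () renaming (‖_‖ to ‖_‖X)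
    open Norm Y using () renaming (‖_‖ to ‖_‖Y)

module Probability (ℝ : CompleteOrderedField) where

  open CompleteOrderedField ℝ renaming (Carrier to R)

  -- ℙ is defined on all predicates, but only its values on measurable ones
  -- are constrained; ℙ-cong merely says that ℙ depends on the extension of
  -- a predicate.
  record ProbabilitySpace (Ω : Set) : Set₁ where
    field
      Measurable      : Pred (Pred Ω 0ℓ) 0ℓ
      measurable-resp : ∀ {E F} → E ≐ F → Measurable E → Measurable F
      measurable-U    : Measurable U
      measurable-∁    : ∀ {E} → Measurable E → Measurable (∁ E)
      measurable-⋃    : ∀ (E : ℕ → Pred Ω 0ℓ) →
                        (∀ n → Measurable (E n)) → Measurable (⋃ ℕ E)

      ℙ               : Pred Ω 0ℓ → R
      ℙ-cong          : ∀ {E F} → E ≐ F → ℙ E ≈ ℙ F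
      ℙ-nonNeg        : ∀ {E} → Measurable E → 0# ≤ ℙ E
      ℙ-U             : ℙ U ≈ 1#
      -- The sum of a series of nonnegative terms is the supremum of its
      -- partial sums.
      ℙ-⋃             : ∀ (E : ℕ → Pred Ω 0ℓ) → (∀ n → Measurable (E n)) →
                        (∀ m n → m ≢ n → Empty (E m ∩ E n)) →
                        IsSup (λ r → ∃[ n ] r ≈ sum {n} (λ j → ℙ (E (toℕ j)))) (ℙ (⋃ ℕ E))

  -- Independence of the two parties' coins: the joint law is the product of
  -- the two laws.
  record PrivateCoins : Set₁ where
    field
      ΩA ΩB : Set
      coinA : ProbabilitySpace ΩA
      coinB : ProbabilitySpace ΩB
      joint : ProbabilitySpace (ΩA × ΩB)

    private
      module A = ProbabilitySpace coinA
      module B = ProbabilitySpace coinB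
      module J = ProbabilitySpace joint

    field
      measurable-⟨×⟩ : ∀ {E F} → A.Measurable E → B.Measurable F → J.Measurable (E ⟨×⟩ F)
      independent    : ∀ {E F} → A.Measurable E → B.Measurable F →
                       J.ℙ (E ⟨×⟩ F) ≈ A.ℙ E * B.ℙ F

module Communication (ℝ : CompleteOrderedField) where

  open CompleteOrderedField ℝ renaming (Carrier to R)
  open Spaces ℝ
  open Probability ℝ

  -- A bit computed from a party's own input and its own coins.
  record RandomBit (I : Setoid 0ℓ 0ℓ) {Ω : Set} (P : ProbabilitySpace Ω) : Set₁ where
    private module I = Setoid I
    open ProbabilitySpace P
    field
      bit        : I.Carrier → Ω → Bool
      bit-cong   : ∀ {x y} → x I.≈ y → ∀ ω → bit x ω ≡ bit y ω
      measurable : ∀ x → Measurable (λ ω → bit x ω ≡ true)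

  record RandomReal (I : Setoid 0ℓ 0ℓ) {Ω : Set} (P : ProbabilitySpace Ω) : Set₁ where
    private module I = Setoid I
    open ProbabilitySpace P
    field
      value      : I.Carrier → Ω → R
      value-cong : ∀ {x y} → x I.≈ y → ∀ ω → value x ω ≈ value y ω
      measurable : ∀ x t → Measurable (λ ω → value x ω ≤ t)

  -- A node of the protocol tree is a transcript: it determines who speaks
  -- next, and the speaker's bit selects the child.  At a leaf Bob outputs.
  data Tree (A B : Setoid 0ℓ 0ℓ) (coins : PrivateCoins) : Set₁ where
    output : RandomReal B (PrivateCoins.coinB coins) → Tree A B coins
    alice  : RandomBit A (PrivateCoins.coinA coins) → (Bool → Tree A B coins) → Tree A B coins
    bob    : RandomBit B (PrivateCoins.coinB coins) → (Bool → Tree A B coins) → Tree A B coins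

  record Protocol (A B : Setoid 0ℓ 0ℓ) : Set₁ where
    field
      coins : PrivateCoins
      tree  : Tree A B coins

  module _ {A B : Setoid 0ℓ 0ℓ} {coins : PrivateCoins} where

    open Setoid A using () renaming (Carrier to InputA)
    open Setoid B using () renaming (Carrier to InputB)
    open PrivateCoins coins
    open RandomBit
    open RandomReal

    bits : Tree A B coins → InputA → InputB → ΩA × ΩB → ℕ
    bits (output _)  a b ω         = 0
    bits (alice m t) a b (ωA , ωB) = ℕ.suc (bits (t (bit m a ωA)) a b (ωA , ωB))
    bits (bob m t)   a b (ωA , ωB) = ℕ.suc (bits (t (bit m b ωB)) a b (ωA , ωB))

    answer : Tree A B coins → InputA → InputB → ΩA × ΩB → R
    answer (output r)  a b (ωA , ωB) = value r b ωB
    answer (alice m t) a b (ωA , ωB) = answer (t (bit m a ωA)) a b (ωA , ωB)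
    answer (bob m t)   a b (ωA , ωB) = answer (t (bit m b ωB)) a b (ωA , ωB)

    IsOneWay : Tree A B coins → Set
    IsOneWay (output _)  = ⊤
    IsOneWay (alice _ t) = ∀ β → IsOneWay (t β)
    IsOneWay (bob _ _)   = ⊥

  OneWay : ∀ {A B} → Protocol A B → Set
  OneWay Π = IsOneWay (Protocol.tree Π)

  -- "c is the maximum number of bits exchanged over all inputs and coins".
  HasCost : ∀ {A B} → Protocol A B → ℕ → Set
  HasCost Π c = (∀ a b ω → bits tree a b ω ℕ.≤ c) × ∃[ a ] ∃[ b ] ∃[ ω ] bits tree a b ω ≡ c
    where open Protocol Π

  SolvesIP : ∀ {n} (N : Norm n) → R → R → Protocol (Ball N) (DualBall N) → Set
  SolvesIP N ε δ Π = ∀ ((v , v∈) : Setoid.Carrier (Ball N)) ((w , w∈) : Setoid.Carrier (DualBall N)) →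
    1# - δ ≤ ℙ (λ ω → ∣ answer tree (v , v∈) (w , w∈) ω - ⟨ v , w ⟩ ∣ ≤ ε)
    where
    open Protocol Π
    open ProbabilitySpace (PrivateCoins.joint coins)

  -- Excluded middle is what makes the minimum of a set of costs total.
  module Complexity (em : ExcludedMiddle (suc 0ℓ)) where

    ℛ : ∀ {n} → R → R → Norm n → ℕ ⁺
    ℛ ε δ N = minimum em λ c →
      Σ[ Π ∈ Protocol (Ball N) (DualBall N) ] (SolvesIP N ε δ Π × HasCost Π c)

    ℛ→ : ∀ {n} → R → R → Norm n → ℕ ⁺
    ℛ→ ε δ N = minimum em λ c →
      Σ[ Π ∈ Protocol (Ball N) (DualBall N) ] (OneWay Π × SolvesIP N ε δ Π × HasCost Π c)

{-# OPTIONS --safe #-}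
module Submission where

-- Let i be the embedding of X into Y.  Alice replaces v by i v; Bob replaces w
-- by a vector w′ of the dual ball of Y with ⟨ i v , w′ ⟩ = α⁻¹ ⟨ v , w ⟩ and
-- multiplies the answer by α.  Such a w′ exists by Hahn–Banach, since
-- α⁻¹ ⟨ v , w ⟩ ≤ α⁻¹ ‖ v ‖ ≤ ‖ i v ‖.  Bob's map has to respect the setoid
-- equality, so the extension is made canonical: its value on each basis vector
-- in turn is the least one allowed by the constraints so far, a supremum.

open import Defs
open import Level using (lift; lower; 0ℓ; suc)
open import Axiom.ExcludedMiddle using (ExcludedMiddle)
import Data.Fin.Base as Fin
open import Data.Nat.Base as ℕ using (ℕ)
import Data.Nat.Properties as ℕ
open import Data.Product.Base using (_×_; _,_; ∃; ∃-syntax; Σ-syntax; proj₁; proj₂)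
open import Data.Sum.Base using (_⊎_; inj₁; inj₂)
open import Data.Unit.Base using (tt)
open import Data.Vec.Functional using (Vector; _∷_; head; zipWith)
open import Function.Base using (_∘_)
open import Function.Bundles using (Func; _⇔_; mk⇔; Equivalence)
open import Relation.Binary.Bundles using (Setoid; TotalOrder)
open import Relation.Binary.PropositionalEquality.Core as ≡ using (_≡_)
open import Relation.Nullary using (yes; no; contradiction)
open import Relation.Binary.Construct.Add.Supremum.NonStrict ℕ._≤_ using (_≤⊤⁺; [_]; ≤⁺-trans)
open import Relation.Nullary.Construct.Add.Supremum using ([_])
open import Relation.Nullary.Decidable using (map′)
open import Relation.Unary using (Pred; _≐_)
open import Algebra.Module.Bundles.Raw using (RawLeftModule)
open import Algebra.Module.Morphism.Structures using (module LeftModuleMorphisms)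
import Algebra.Construct.NaturalChoice.Max as Max
import Algebra.Properties.Ring as RingProperties
import Algebra.Properties.Semiring.Sum as Sum
import Algebra.Solver.Ring.NaturalCoefficients.Default as Solver

-- Least costs and attained maxima.

em₀ : ExcludedMiddle (suc 0ℓ) → ExcludedMiddle 0ℓ
em₀ em = map′ lower lift em

module _ (em : ExcludedMiddle (suc 0ℓ)) where

  minimum-≤ : ∀ {P : Pred ℕ (suc 0ℓ)} {c} → P c → minimum em P ≤⁺ [ c ]
  minimum-≤ {P} {c} Pc with em {∃ P}
  ... | yes inhabited = [ proj₂ (proj₂ (least em P inhabited)) c Pc ]
  ... | no  empty     = contradiction (c , Pc) empty

  -- Domination rather than inclusion of `Q` in `P` is assumed because a transformed protocol may be
  -- cheaper than the one it comes from. The least element of `Q` is dominated by some element of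
  -- `P`; if `Q` is empty, its minimum is ∞.
  minimum-mono : ∀ {P Q : Pred ℕ (suc 0ℓ)} →
                 (∀ c → Q c → ∃[ c′ ] (c′ ℕ.≤ c × P c′)) →
                 minimum em P ≤⁺ minimum em Q
  minimum-mono {P} {Q} dominated with em {∃ Q}
  ... | no  _         = _ ≤⊤⁺
  ... | yes inhabited with least em Q inhabited
  ...   | c , Qc , _ with dominated c Qc
  ...     | c′ , c′≤c , Pc′ = ≤⁺-trans ℕ.≤-trans (minimum-≤ Pc′) [ c′≤c ]

  -- Descends from the bound `c`: excluded middle decides whether the current bound is attained, and
  -- if not it drops by one. At bound 0 the point `a₀` attains it.
  max-attained : ∀ {A : Set} (f : A → ℕ) → A → ∀ c → (∀ a → f a ℕ.≤ c) →
                 ∃[ m ] (m ℕ.≤ c × (∀ a → f a ℕ.≤ m) × ∃[ a ] f a ≡ m)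
  max-attained f a₀ ℕ.zero bound = 0 , ℕ.z≤n , bound , a₀ , ℕ.n≤0⇒n≡0 (bound a₀)
  max-attained f a₀ (ℕ.suc c) bound with em₀ em {∃[ a ] f a ≡ ℕ.suc c}
  ... | yes attained = ℕ.suc c , ℕ.≤-refl , bound , attained
  ... | no  missed   =
    let m , m≤c , rest = max-attained f a₀ c
          λ a → ℕ.s≤s⁻¹ (ℕ.≤∧≢⇒< (bound a) λ eq → missed (a , eq))
    in  m , ℕ.m≤n⇒m≤1+n m≤c , rest

-- Arithmetic of the ordered field.

module OrderedField (ℝ : CompleteOrderedField) where

  open CompleteOrderedField ℝ
  open TotalOrder totalOrder public
    using (total; antisym; ≤-respʳ-≈; ≤-respˡ-≈)
    renaming (refl to ≤-refl; trans to ≤-trans; reflexive to ≤-reflexive)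
  open RingProperties ring public using (-1*x≈-x; -‿distribʳ-*; x[y-z]≈xy-xz; -‿involutive)
  open Max totalOrder using (x≤y⇒y⊔x≈y; mono-≤-distrib-⊔; ⊔-cong)
  open Solver commutativeSemiring public using (solve; _:+_; _:*_; _:=_)

  ≤-resp-≈ : ∀ {x x′ y y′} → x ≈ x′ → y ≈ y′ → x ≤ y → x′ ≤ y′
  ≤-resp-≈ p q = ≤-respˡ-≈ p ∘ ≤-respʳ-≈ q

  x-y+y≈x : ∀ x y → (x - y) + y ≈ x
  x-y+y≈x x y = trans (+-assoc x (- y) y) (trans (+-congˡ (-‿inverseˡ y)) (+-identityʳ x))

  x+y-y≈x : ∀ x y → (x + y) - y ≈ x
  x+y-y≈x x y = trans (+-assoc x y (- y)) (trans (+-congˡ (-‿inverseʳ y)) (+-identityʳ x))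

  x≤y⇒0≤y-x : ∀ {x y} → x ≤ y → 0# ≤ y - x
  x≤y⇒0≤y-x {x} = ≤-respˡ-≈ (-‿inverseʳ x) ∘ +-monoˡ-≤ (- x)

  0≤y-x⇒x≤y : ∀ {x y} → 0# ≤ y - x → x ≤ y
  0≤y-x⇒x≤y {x} {y} = ≤-resp-≈ (+-identityˡ x) (x-y+y≈x y x) ∘ +-monoˡ-≤ x

  +-cancelʳ-≤ : ∀ z {x y} → x + z ≤ y + z → x ≤ y
  +-cancelʳ-≤ z {x} {y} = ≤-resp-≈ (x+y-y≈x x z) (x+y-y≈x y z) ∘ +-monoˡ-≤ (- z)

  +-mono-≤ : ∀ {x x′ y y′} → x ≤ x′ → y ≤ y′ → x + y ≤ x′ + y′
  +-mono-≤ {x} {x′} {y} {y′} x≤x′ y≤y′ =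
    ≤-trans (+-monoˡ-≤ y x≤x′) (≤-resp-≈ (+-comm y x′) (+-comm y′ x′) (+-monoˡ-≤ x′ y≤y′))

  *-monoˡ-≤ : ∀ {a x y} → 0# ≤ a → x ≤ y → a * x ≤ a * y
  *-monoˡ-≤ {a} {x} {y} 0≤a x≤y =
    0≤y-x⇒x≤y (≤-respʳ-≈ (x[y-z]≈xy-xz a y x) (*-nonNeg 0≤a (x≤y⇒0≤y-x x≤y)))

  neg-antimono-≤ : ∀ {x y} → x ≤ y → - y ≤ - x
  neg-antimono-≤ {x} {y} x≤y = 0≤y-x⇒x≤y (≤-respʳ-≈
    (trans (+-congʳ (sym (-‿involutive y))) (+-comm (- - y) (- x))) (x≤y⇒0≤y-x x≤y))

  neg-cancel-≤ : ∀ {x y} → - y ≤ - x → x ≤ y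
  neg-cancel-≤ {x} {y} = ≤-resp-≈ (-‿involutive x) (-‿involutive y) ∘ neg-antimono-≤

  x≤0⇒0≤-x : ∀ {x} → x ≤ 0# → 0# ≤ - x
  x≤0⇒0≤-x {x} = ≤-respʳ-≈ (+-identityˡ (- x)) ∘ x≤y⇒0≤y-x

  0≤1 : 0# ≤ 1#
  0≤1 with total 0# 1#
  ... | inj₁ 0≤1 = 0≤1
  -- Here -1 is nonnegative, hence so is its square 1.
  ... | inj₂ 1≤0 = ≤-respʳ-≈ (trans (-1*x≈-x (- 1#)) (-‿involutive 1#)) (*-nonNeg 0≤-1 0≤-1)
    where 0≤-1 = x≤0⇒0≤-x 1≤0

  *-inverseˡ : ∀ {a} → 0# < a → a ⁻¹ * a ≈ 1#
  *-inverseˡ {a} (_ , 0≉a) = trans (*-comm (a ⁻¹) a) (*-inverseʳ (0≉a ∘ sym))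

  x⁻¹[xy]≈y : ∀ {x} → 0# < x → ∀ y → x ⁻¹ * (x * y) ≈ y
  x⁻¹[xy]≈y 0<x y = trans (sym (*-assoc _ _ y)) (trans (*-congʳ (*-inverseˡ 0<x)) (*-identityˡ y))

  x[x⁻¹y]≈y : ∀ {x} → 0# < x → ∀ y → x * (x ⁻¹ * y) ≈ y
  x[x⁻¹y]≈y {x} 0<x@(_ , 0≉x) y =
    trans (sym (*-assoc _ _ y)) (trans (*-congʳ (*-inverseʳ (0≉x ∘ sym))) (*-identityˡ y))

  0≤x⁻¹ : ∀ {x} → 0# < x → 0# ≤ x ⁻¹
  0≤x⁻¹ {x} 0<x@(0≤x , 0≉x) with total 0# (x ⁻¹)
  ... | inj₁ 0≤x⁻¹ = 0≤x⁻¹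
  ... | inj₂ x⁻¹≤0 = contradiction
    (antisym 0≤1 (≤-resp-≈ (*-inverseʳ (0≉x ∘ sym)) (zeroʳ x) (*-monoˡ-≤ 0≤x x⁻¹≤0))) 0≉1

  *-≤⇔≤-⁻¹* : ∀ {a x y} → 0# < a → (a * x ≤ y) ⇔ (x ≤ a ⁻¹ * y)
  *-≤⇔≤-⁻¹* {a} {x} {y} 0<a@(0≤a , _) = mk⇔
    (≤-respˡ-≈ (x⁻¹[xy]≈y 0<a x) ∘ *-monoˡ-≤ (0≤x⁻¹ 0<a))
    (≤-respʳ-≈ (x[x⁻¹y]≈y 0<a y) ∘ *-monoˡ-≤ 0≤a)

  ∣∣-cong : ∀ {x y} → x ≈ y → ∣ x ∣ ≈ ∣ y ∣
  ∣∣-cong x≈y = ⊔-cong x≈y (-‿cong x≈y)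

  0≤x⇒∣x∣≈x : ∀ {x} → 0# ≤ x → ∣ x ∣ ≈ x
  0≤x⇒∣x∣≈x {x} 0≤x = x≤y⇒y⊔x≈y (≤-trans -x≤0 0≤x)
    where -x≤0 = neg-cancel-≤ (≤-resp-≈ (sym (trans (sym (-1*x≈-x 0#)) (zeroʳ _))) (sym (-‿involutive x)) 0≤x)

  -- Multiplication by a nonnegative `a` is monotone, so it distributes over the maximum of `x` and
  -- `- x`.
  ∣ax∣≈a∣x∣ : ∀ {a} → 0# ≤ a → ∀ x → ∣ a * x ∣ ≈ a * ∣ x ∣
  ∣ax∣≈a∣x∣ {a} 0≤a x = trans (⊔-cong refl (-‿distribʳ-* a x))
    (sym (mono-≤-distrib-⊔ *-congˡ (*-monoˡ-≤ 0≤a) x (- x)))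

  IsSup-unique : ∀ {P Q s t} → P ≐ Q → IsSup P s → IsSup Q t → s ≈ t
  IsSup-unique (P⊆Q , Q⊆P) (s-upper , s-least) (t-upper , t-least) = antisym
    (s-least _ λ x → t-upper x ∘ P⊆Q)
    (t-least _ λ x → s-upper x ∘ Q⊆P)

-- Linearity of the inner product.

module InnerProduct (ℝ : CompleteOrderedField) where

  open CompleteOrderedField ℝ renaming (Carrier to R)
  open OrderedField ℝ
  open Spaces ℝ
  open Sum semiring using (sum-cong-≋; ∑-distrib-+; *-distribˡ-sum)
  open module V {n} = RawLeftModule (ℝ^ n) public using (_+ᴹ_; _*ₗ_; 0ᴹ)

  ⟨⟩-cong : ∀ {n} {v v′ w w′ : Vector R n} → v ≋ v′ → w ≋ w′ → ⟨ v , w ⟩ ≈ ⟨ v′ , w′ ⟩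
  ⟨⟩-cong v≋v′ w≋w′ = sum-cong-≋ λ j → *-cong (v≋v′ j) (w≋w′ j)

  ⟨⟩-distribʳ-+ : ∀ {n} (u v w : Vector R n) → ⟨ u +ᴹ v , w ⟩ ≈ ⟨ u , w ⟩ + ⟨ v , w ⟩
  ⟨⟩-distribʳ-+ u v w = trans (sum-cong-≋ λ j → distribʳ (w j) (u j) (v j))
    (∑-distrib-+ (λ j → u j * w j) (λ j → v j * w j))

  ⟨⟩-*ₗ : ∀ {n} a (v w : Vector R n) → ⟨ a *ₗ v , w ⟩ ≈ a * ⟨ v , w ⟩
  ⟨⟩-*ₗ a v w = trans (sum-cong-≋ λ j → *-assoc a (v j) (w j))
    (sym (*-distribˡ-sum a (zipWith _*_ v w)))

  ⟨⟩-zeroˡ : ∀ {n} (w : Vector R n) → ⟨ 0ᴹ , w ⟩ ≈ 0#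
  ⟨⟩-zeroˡ {n} w = trans (⟨⟩-cong {n} {w = w} (λ _ → sym (zeroˡ 0#)) (λ _ → refl))
    (trans (⟨⟩-*ₗ 0# 0ᴹ w) (zeroˡ _))

-- Hahn-Banach extension, eliminating one coordinate at a time.

module HahnBanach (em : ExcludedMiddle (suc 0ℓ)) (ℝ : CompleteOrderedField) where

  open CompleteOrderedField ℝ renaming (Carrier to R)
  open OrderedField ℝ
  open Spaces ℝ
  open InnerProduct ℝ

  sign : ∀ t → 0# < t ⊎ t ≈ 0# ⊎ 0# < - t
  sign t with em₀ em {t ≈ 0#} | total 0# t
  ... | yes t≈0 | _        = inj₂ (inj₁ t≈0)
  ... | no  t≉0 | inj₁ 0≤t = inj₁ (0≤t , t≉0 ∘ sym)
  ... | no  t≉0 | inj₂ t≤0 = inj₂ (inj₂ (x≤0⇒0≤-x t≤0 ,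
    λ 0≈-t → t≉0 (trans (sym (+-identityʳ t)) (trans (+-congˡ 0≈-t) (-‿inverseʳ t)))))

  -- H y r stands for the constraint r ≤ g y on a linear functional g that is
  -- still to be found.
  record Cone (n : ℕ) : Set₁ where
    field
      H      : Vector R n → R → Set
      resp   : ∀ {y y′ r r′} → y ≋ y′ → r ≈ r′ → H y r → H y′ r′
      add    : ∀ {y y′ r r′} → H y r → H y′ r′ → H (y +ᴹ y′) (r + r′)
      scale  : ∀ {a y r} → 0# ≤ a → H y r → H (a *ₗ y) (a * r)
      serial : ∀ y → ∃ (H y)
      proper : ∀ {r} → H 0ᴹ r → r ≤ 0#

  module Slice {n} (C : Cone (ℕ.suc n)) where
    open Cone C

    -- Constraints at the first basis vector bound the value of `g` there from below, those at its
    -- negative from above. Two such constraints add up to one at 0, so properness makes them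
    -- compatible.
    opposite : ∀ {r s} → H (1# ∷ 0ᴹ) r → H (- 1# ∷ 0ᴹ) s → r + s ≤ 0#
    opposite p q = proper (resp
      (λ { Fin.zero → -‿inverseʳ 1# ; (Fin.suc j) → +-identityʳ 0# }) refl (add p q))

    supremum : ∃ (IsSup (H (1# ∷ 0ᴹ)))
    supremum = let s , q = serial (- 1# ∷ 0ᴹ) in
      complete (H (1# ∷ 0ᴹ)) (serial (1# ∷ 0ᴹ))
        (- s , λ r p → +-cancelʳ-≤ s (≤-respʳ-≈ (sym (-‿inverseˡ s)) (opposite p q)))

    c : R
    c = proj₁ supremum

    -- The constraints on g ∘ (0# ∷_) once g (1# ∷ 0ᴹ) = c.
    H′ : Vector R n → R → Set
    H′ y r = ∃[ t ] H (t ∷ y) (r + t * c)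

    -- Fixing the value `c` must not make the constraints contradictory. The sign of `t` decides
    -- which half of the supremum property of `c` is used; if `t` is zero, properness of the given
    -- cone suffices.
    H′-proper : ∀ {r} → H′ 0ᴹ r → r ≤ 0#
    H′-proper {r} (t , h) with sign t
    ... | inj₂ (inj₁ t≈0) = proper (resp
      (λ { Fin.zero → t≈0 ; (Fin.suc j) → refl })
      (trans (+-congˡ (trans (*-congʳ t≈0) (zeroˡ c))) (+-identityʳ r)) h)
    -- Dividing `h` by `t` gives a constraint at the first basis vector, so `t ⁻¹ * r + c` is at
    -- most the upper bound `c`.
    ... | inj₁ 0<t = ≤-respʳ-≈ (zeroʳ t)
      (≤-respˡ-≈ (x[x⁻¹y]≈y 0<t r) (*-monoˡ-≤ (proj₁ 0<t) (+-cancelʳ-≤ c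
        (≤-respʳ-≈ (sym (+-identityˡ c)) (proj₁ (proj₂ supremum) (t ⁻¹ * r + c) h₁)))))
      where
      h₁ : H (1# ∷ 0ᴹ) (t ⁻¹ * r + c)
      h₁ = resp (λ { Fin.zero → *-inverseˡ 0<t ; (Fin.suc j) → zeroʳ (t ⁻¹) })
        (trans (distribˡ (t ⁻¹) r (t * c)) (+-congˡ (x⁻¹[xy]≈y 0<t c)))
        (scale (0≤x⁻¹ 0<t) h)
    -- Dividing `h` by `- t` gives a constraint at the negated basis vector. By `opposite`,
    -- `c - u * r` is an upper bound of the set whose least upper bound is `c`; hence `u * r`, and
    -- with it `r`, is at most 0.
    ... | inj₂ (inj₂ 0<s) = ≤-respʳ-≈ (zeroʳ s)
      (≤-respˡ-≈ (x[x⁻¹y]≈y 0<s r) (*-monoˡ-≤ (proj₁ 0<s) (+-cancelʳ-≤ (c - u * r)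
        (≤-resp-≈
          (trans (sym (x-y+y≈x c (u * r))) (+-comm (c - u * r) (u * r)))
          (sym (+-identityˡ _))
          (proj₂ (proj₂ supremum) (c - u * r) bound)))))
      where
      s u : R
      s = - t
      u = s ⁻¹

      u*t≈-1 : u * t ≈ - 1#
      u*t≈-1 = trans (*-congˡ (sym (-‿involutive t)))
        (trans (sym (-‿distribʳ-* u s)) (-‿cong (*-inverseˡ 0<s)))

      h₁ : H (- 1# ∷ 0ᴹ) (u * r - c)
      h₁ = resp (λ { Fin.zero → u*t≈-1 ; (Fin.suc j) → zeroʳ u })
        (trans (distribˡ u r (t * c)) (+-congˡ (trans (sym (*-assoc u t c))
          (trans (*-congʳ u*t≈-1) (-1*x≈-x c)))))
        (scale (0≤x⁻¹ 0<s) h)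

      bound : IsUpperBound (H (1# ∷ 0ᴹ)) (c - u * r)
      bound r′ p = +-cancelʳ-≤ (u * r - c) (≤-respʳ-≈ (sym cancel) (opposite p h₁))
        where
        cancel : (c - u * r) + (u * r - c) ≈ 0#
        cancel = trans (sym (+-assoc _ (u * r) (- c)))
          (trans (+-congʳ (x-y+y≈x c (u * r))) (-‿inverseʳ c))

    slice : Cone n
    slice = record
      { H      = H′
      ; resp   = λ { y≋y′ r≈r′ (t , h) → t , resp
          (λ { Fin.zero → refl ; (Fin.suc j) → y≋y′ j }) (+-congʳ r≈r′) h }
      ; add    = λ { {r = r} {r′} (t , h) (t′ , h′) → t + t′ , resp
          (λ { Fin.zero → refl ; (Fin.suc j) → refl })
          (solve 5 (λ r t r′ t′ c → (r :+ t :* c) :+ (r′ :+ t′ :* c) :=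
            (r :+ r′) :+ (t :+ t′) :* c) refl r t r′ t′ c)
          (add h h′) }
      ; scale  = λ { {a} {r = r} 0≤a (t , h) → a * t , resp
          (λ { Fin.zero → refl ; (Fin.suc j) → refl })
          (solve 4 (λ a r t c → a :* (r :+ t :* c) := a :* r :+ (a :* t) :* c) refl a r t c)
          (scale 0≤a h) }
      ; serial = λ y → let r , h = serial (0# ∷ y) in r , 0# , resp
          (λ { Fin.zero → refl ; (Fin.suc j) → refl })
          (sym (trans (+-congˡ (zeroˡ c)) (+-identityʳ r))) h
      ; proper = H′-proper
      }

  open Cone
  open Slice using (slice; supremum)

  functional : ∀ {n} → Cone n → Vector R n
  functional {ℕ.zero}  C = λ ()
  functional {ℕ.suc n} C = proj₁ (supremum C) ∷ functional (slice C)

  -- Induction on the dimension. Subtracting the first coordinate's share `y₀c` moves the constraint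
  -- to the slice, with `head y` as the witness `t`. In dimension 0 the inner product is an empty
  -- sum and properness applies.
  functional-dominates : ∀ {n} (C : Cone n) {y r} → H C y r → r ≤ ⟨ y , functional C ⟩
  functional-dominates {ℕ.zero}  C h = proper C (resp C (λ ()) refl h)
  functional-dominates {ℕ.suc n} C {y} {r} h =
    ≤-resp-≈ (x-y+y≈x r y₀c) (+-comm _ y₀c) (+-monoˡ-≤ y₀c
      (functional-dominates (slice C) (head y , resp C
        (λ { Fin.zero → refl ; (Fin.suc j) → refl }) (sym (x-y+y≈x r y₀c)) h)))
    where y₀c = head y * proj₁ (supremum C)

  -- Equivalent cones have equal suprema, and then equivalent slices, so the functional depends on
  -- the constraints alone. In dimension 0 there is no coordinate to compare.
  functional-cong : ∀ {n} {C D : Cone n} →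
    (∀ {y r} → H C y r → H D y r) → (∀ {y r} → H D y r → H C y r) →
    functional C ≋ functional D
  functional-cong {ℕ.suc n} {C} {D} C⊆D D⊆C = λ { Fin.zero → c≈d ; (Fin.suc j) → tails j }
    where
    c≈d : proj₁ (supremum C) ≈ proj₁ (supremum D)
    c≈d = IsSup-unique (C⊆D , D⊆C) (proj₂ (supremum C)) (proj₂ (supremum D))

    tails : functional (slice C) ≋ functional (slice D)
    tails = functional-cong
      (λ { (t , h) → t , resp D (λ _ → refl) (+-congˡ (*-congˡ c≈d)) (C⊆D h) })
      (λ { (t , h) → t , resp C (λ _ → refl) (+-congˡ (*-congˡ (sym c≈d))) (D⊆C h) })

-- Dual balls, and the maps on inputs induced by the embedding.

module Adjoint (em : ExcludedMiddle (suc 0ℓ)) (ℝ : CompleteOrderedField) where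

  open CompleteOrderedField ℝ renaming (Carrier to R)
  open OrderedField ℝ
  open Spaces ℝ
  open InnerProduct ℝ
  open HahnBanach em ℝ

  -1*-cancel-≤ : ∀ {x y} → - 1# * x ≤ - 1# * y → y ≤ x
  -1*-cancel-≤ {x} {y} = neg-cancel-≤ ∘ ≤-resp-≈ (-1*x≈-x x) (-1*x≈-x y)

  module _ {n} (N : Norm n) where
    open Norm N

    ‖0‖≈0 : ‖ 0ᴹ ‖ ≈ 0#
    ‖0‖≈0 = trans (‖‖-cong (λ _ → sym (zeroˡ 0#)))
      (trans (homogeneous 0# 0ᴹ) (trans (*-congʳ (0≤x⇒∣x∣≈x ≤-refl)) (zeroˡ _)))

    ‖av‖≈a‖v‖ : ∀ {a} → 0# ≤ a → ∀ v → ‖ a *ₗ v ‖ ≈ a * ‖ v ‖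
    ‖av‖≈a‖v‖ 0≤a v = trans (homogeneous _ v) (*-congʳ (0≤x⇒∣x∣≈x 0≤a))

    0∈Ball : Setoid.Carrier (Ball N)
    0∈Ball = 0ᴹ , ≤-respˡ-≈ (sym ‖0‖≈0) 0≤1

    -- A point of the dual ball carries its dual norm as an explicit supremum. Completeness supplies
    -- it: the zero vector shows that the set is inhabited, and 1 bounds it.
    bounded⇒dual : ∀ w → (∀ v → ‖ v ‖ ≤ 1# → ⟨ v , w ⟩ ≤ 1#) → Setoid.Carrier (DualBall N)
    bounded⇒dual w bound = w , proj₁ dual , proj₂ dual , proj₂ (proj₂ dual) 1# upper
      where
      P : Pred R 0ℓ
      P r = Σ[ v ∈ Vector R n ] (‖ v ‖ ≤ 1# × r ≈ ⟨ v , w ⟩)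

      upper : IsUpperBound P 1#
      upper r (v , ‖v‖≤1 , r≈) = ≤-respˡ-≈ (sym r≈) (bound v ‖v‖≤1)

      dual : ∃ (IsSup P)
      dual = complete P (⟨ 0ᴹ , w ⟩ , 0ᴹ , proj₂ 0∈Ball , refl) (1# , upper)

    0∈DualBall : Setoid.Carrier (DualBall N)
    0∈DualBall = bounded⇒dual 0ᴹ λ v _ → ≤-respˡ-≈ (sym (v·0≈0 v)) 0≤1
      where
      v·0≈0 : ∀ v → ⟨ v , 0ᴹ ⟩ ≈ 0#
      v·0≈0 v = trans (Sum.sum-cong-≋ semiring {n} {λ j → v j * 0#} {λ j → 0# * v j}
        λ j → *-comm (v j) 0#) (⟨⟩-zeroˡ v)

    -- Scaling `v` to norm 1 brings it into the ball, where its pairing with `w` is at most `s`. A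
    -- vector of norm 0 cannot be scaled so, but it is 0 by definiteness.
    dual-bound : ∀ ((w , _) : Setoid.Carrier (DualBall N)) v → ⟨ v , w ⟩ ≤ ‖ v ‖
    dual-bound (w , s , (upper , _) , s≤1) v with em₀ em {‖ v ‖ ≈ 0#}
    ... | yes ‖v‖≈0 = ≤-reflexive (trans
      (trans (⟨⟩-cong {w = w} (definite ‖v‖≈0) (λ _ → refl)) (⟨⟩-zeroˡ w)) (sym ‖v‖≈0))
    ... | no  ‖v‖≉0 = ≤-resp-≈ (x[x⁻¹y]≈y 0<‖v‖ _) (*-identityʳ ‖ v ‖)
      (*-monoˡ-≤ (nonNeg v) (≤-trans
        (upper _ (‖ v ‖ ⁻¹ *ₗ v , ≤-reflexive normalised , sym (⟨⟩-*ₗ (‖ v ‖ ⁻¹) v w))) s≤1))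
      where
      0<‖v‖ : 0# < ‖ v ‖
      0<‖v‖ = nonNeg v , ‖v‖≉0 ∘ sym

      normalised : ‖ ‖ v ‖ ⁻¹ *ₗ v ‖ ≈ 1#
      normalised = trans (‖av‖≈a‖v‖ (0≤x⁻¹ 0<‖v‖) v) (*-inverseˡ 0<‖v‖)

  module _ {k n} (X : Norm k) (Y : Norm n) {α : R} (0<α : 0# < α) (X↪Y : Embeds X Y α) where

    open Norm X using () renaming (‖_‖ to ‖_‖X)
    open Norm Y using (triangle; ‖‖-cong) renaming (‖_‖ to ‖_‖Y)

    i : Vector R k → Vector R n
    i = proj₁ X↪Y

    open LeftModuleMorphisms.IsLeftModuleHomomorphism (proj₁ (proj₂ X↪Y))

    embedBall : Func (Ball X) (Ball Y)
    embedBall = record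
      { to   = λ (v , ‖v‖≤1) → i v , ≤-trans (proj₁ (proj₂ (proj₂ X↪Y) v)) ‖v‖≤1
      ; cong = ⟦⟧-cong
      }

    module _ (w : Setoid.Carrier (DualBall X)) where

      f : Vector R k → R
      f x = α ⁻¹ * ⟨ x , proj₁ w ⟩

      f-+ : ∀ x x′ → f (x +ᴹ x′) ≈ f x + f x′
      f-+ x x′ = trans (*-congˡ (⟨⟩-distribʳ-+ x x′ (proj₁ w))) (distribˡ _ _ _)

      f-* : ∀ a x → f (a *ₗ x) ≈ a * f x
      f-* a x = trans (*-congˡ (⟨⟩-*ₗ a x (proj₁ w)))
        (solve 3 (λ b a p → b :* (a :* p) := a :* (b :* p)) refl (α ⁻¹) a _)

      f-0 : f 0ᴹ ≈ 0#
      f-0 = trans (*-congˡ (⟨⟩-zeroˡ (proj₁ w))) (zeroʳ _)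

      -- The bound of `‖ x ‖X` by `α * ‖ i x ‖Y` enters here; the result makes `cone` proper.
      f≤‖i‖ : ∀ x → f x ≤ ‖ i x ‖Y
      f≤‖i‖ x = ≤-respʳ-≈ (x⁻¹[xy]≈y 0<α _) (*-monoˡ-≤ (0≤x⁻¹ 0<α)
        (≤-trans (dual-bound X w x) (proj₂ (proj₂ (proj₂ X↪Y) x))))

      -- If g ∘ i = f and g ≤ ‖_‖Y, then g y = f x - g z ≥ f x - ‖ z ‖Y whenever
      -- i x = y + z.
      Forced : Vector R n → R → Set
      Forced y r = Σ[ x ∈ Vector R k ] Σ[ z ∈ Vector R n ] (i x ≋ y +ᴹ z × r + ‖ z ‖Y ≤ f x)

      cone : Cone n
      cone = record
        { H      = Forced
        ; resp   = λ { y≋y′ r≈r′ (x , z , ix≋ , r≤) →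
            x , z , (λ j → trans (ix≋ j) (+-congʳ (y≋y′ j))) , ≤-respˡ-≈ (+-congʳ r≈r′) r≤ }
        -- The triangle inequality bounds the norm of `z +ᴹ z′` by the sum of the norms, and `f` is
        -- additive.
        ; add    = λ { {y} {y′} {r} {r′} (x , z , ix≋ , r≤) (x′ , z′ , ix′≋ , r′≤) →
            x +ᴹ x′ , z +ᴹ z′
            , (λ j → trans (+ᴹ-homo x x′ j) (trans (+-cong (ix≋ j) (ix′≋ j))
                (interchange (y j) (z j) (y′ j) (z′ j))))
            , ≤-trans
                (≤-resp-≈ (+-comm _ (r + r′)) (+-comm _ (r + r′)) (+-monoˡ-≤ (r + r′) (triangle z z′)))
                (≤-resp-≈ (interchange r _ r′ _) (sym (f-+ x x′)) (+-mono-≤ r≤ r′≤)) }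
        ; scale  = λ { {a} {y} {r} 0≤a (x , z , ix≋ , r≤) →
            a *ₗ x , a *ₗ z
            , (λ j → trans (*ₗ-homo a x j) (trans (*-congˡ (ix≋ j)) (distribˡ a (y j) (z j))))
            , ≤-resp-≈
                (trans (distribˡ a r _) (+-congˡ (sym (‖av‖≈a‖v‖ Y 0≤a z))))
                (sym (f-* a x)) (*-monoˡ-≤ 0≤a r≤) }
        -- Take `x` zero and `z` the negative of `y`.
        ; serial = λ y → - ‖ - 1# *ₗ y ‖Y , 0ᴹ , - 1# *ₗ y
            , (λ j → trans (0ᴹ-homo j) (sym (trans (+-congˡ (-1*x≈-x (y j))) (-‿inverseʳ (y j)))))
            , ≤-reflexive (trans (-‿inverseˡ _) (sym f-0))
        -- At the zero vector `z` equals `i x`, so `f x` is at most `‖ z ‖Y`.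
        ; proper = λ { {r} (x , z , ix≋ , r≤) → +-cancelʳ-≤ ‖ z ‖Y (≤-trans r≤
            (≤-respʳ-≈ (trans (‖‖-cong (λ j → trans (ix≋ j) (+-identityˡ (z j))))
              (sym (+-identityˡ _))) (f≤‖i‖ x))) }
        }
        where
        interchange : ∀ a b c d → (a + b) + (c + d) ≈ (a + c) + (b + d)
        interchange = solve 4 (λ a b c d → (a :+ b) :+ (c :+ d) := (a :+ c) :+ (b :+ d)) refl

      extension : Vector R n
      extension = functional cone

      -- With `x` zero, the value at the negative of `z` is forced to be at least `- ‖ z ‖Y`; negate
      -- both sides.
      extension-≤ : ∀ z → ⟨ z , extension ⟩ ≤ ‖ z ‖Y
      extension-≤ z = neg-cancel-≤ (≤-respʳ-≈
        (trans (⟨⟩-*ₗ (- 1#) z extension) (-1*x≈-x _))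
        (functional-dominates cone
          ( 0ᴹ , z
          , (λ j → trans (0ᴹ-homo j) (sym (trans (+-congʳ (-1*x≈-x (z j))) (-‿inverseˡ (z j)))))
          , ≤-reflexive (trans (-‿inverseˡ _) (sym f-0)))))

      f≤extension : ∀ x → f x ≤ ⟨ i x , extension ⟩
      f≤extension x = functional-dominates cone
        ( x , 0ᴹ , (λ j → sym (+-identityʳ (i x j)))
        , ≤-reflexive (trans (+-congˡ (‖0‖≈0 Y)) (+-identityʳ (f x))))

      -- Both sides are linear in `x`, so `f≤extension` at the negative of `x` gives the reverse
      -- inequality.
      extension-extends : ∀ x → ⟨ i x , extension ⟩ ≈ f x
      extension-extends x = antisym
        (-1*-cancel-≤ (≤-resp-≈ (f-* (- 1#) x)
          (trans (⟨⟩-cong {w = extension} (*ₗ-homo (- 1#) x) (λ _ → refl))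
            (⟨⟩-*ₗ (- 1#) (i x) extension))
          (f≤extension (- 1# *ₗ x))))
        (f≤extension x)

    -- `w` enters the cone only through `f w`, so equal vectors impose the same constraints.
    extension-cong : ∀ w w′ → proj₁ w ≋ proj₁ w′ → extension w ≋ extension w′
    extension-cong w w′ w≋w′ = functional-cong {C = cone w} {cone w′}
      (λ { (x , z , ix≋ , r≤) → x , z , ix≋ , ≤-respʳ-≈ (f≈f′ x) r≤ })
      (λ { (x , z , ix≋ , r≤) → x , z , ix≋ , ≤-respʳ-≈ (sym (f≈f′ x)) r≤ })
      where
      f≈f′ : ∀ x → f w x ≈ f w′ x
      f≈f′ x = *-congˡ (⟨⟩-cong {v = x} (λ _ → refl) w≋w′)

    extendDual : Func (DualBall X) (DualBall Y)
    extendDual = record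
      { to   = λ w → bounded⇒dual Y (extension w) λ v → ≤-trans (extension-≤ w v)
      ; cong = λ {w} {w′} → extension-cong w w′
      }

    extendDual-pairing : ∀ ((v , _) : Setoid.Carrier (Ball X)) (w : Setoid.Carrier (DualBall X)) →
      α * ⟨ i v , proj₁ (Func.to extendDual w) ⟩ ≈ ⟨ v , proj₁ w ⟩
    extendDual-pairing (v , _) w =
      trans (*-congˡ (extension-extends w v)) (x[x⁻¹y]≈y 0<α _)

-- Pulling protocols back along maps of the inputs.

module Pullback (em : ExcludedMiddle (suc 0ℓ)) (ℝ : CompleteOrderedField) where

  open CompleteOrderedField ℝ renaming (Carrier to R)
  open OrderedField ℝ
  open Spaces ℝ
  open Probability ℝ
  open Communication ℝ
  open Adjoint em ℝ using (0∈Ball; 0∈DualBall)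

  module _ {A A′ B B′ : Setoid 0ℓ 0ℓ} (φ : Func A A′) (ψ : Func B B′) {α : R} (0<α : 0# < α) where

    pullBit : ∀ {I I′ : Setoid 0ℓ 0ℓ} {Ω} {P : ProbabilitySpace Ω} →
              Func I I′ → RandomBit I′ P → RandomBit I P
    pullBit θ m = record
      { bit        = bit ∘ to
      ; bit-cong   = bit-cong ∘ cong
      ; measurable = measurable ∘ to
      }
      where
      open RandomBit m
      open Func θ

    pullOutput : ∀ {Ω} {P : ProbabilitySpace Ω} → RandomReal B′ P → RandomReal B P
    pullOutput {P = P} r = record
      { value      = λ b ω → α * value (to b) ω
      ; value-cong = λ b≈b′ ω → *-congˡ (value-cong (cong b≈b′) ω)
      -- As `α` is positive, the scaled value is at most `t` exactly when the original one is at
      -- most `α ⁻¹ * t`.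
      ; measurable = λ b t → measurable-resp
          ( Equivalence.from (*-≤⇔≤-⁻¹* 0<α) , Equivalence.to (*-≤⇔≤-⁻¹* 0<α) )
          (measurable (to b) (α ⁻¹ * t))
      }
      where
      open RandomReal r
      open ProbabilitySpace P using (measurable-resp)
      open Func ψ

    module _ {coins : PrivateCoins} where

      open Func φ using () renaming (to to φ⟨_⟩)
      open Func ψ using () renaming (to to ψ⟨_⟩)

      -- Each party applies its own map to its own input without communicating, so no bit is added
      -- and the order of speakers is kept.
      pull : Tree A′ B′ coins → Tree A B coins
      pull (output r)  = output (pullOutput r)
      pull (alice m t) = alice (pullBit φ m) (pull ∘ t)
      pull (bob m t)   = bob (pullBit ψ m) (pull ∘ t)

      bits-pull : ∀ t a b ω → bits (pull t) a b ω ≡ bits t φ⟨ a ⟩ ψ⟨ b ⟩ ω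
      bits-pull (output r)  a b ω = ≡.refl
      bits-pull (alice m t) a b ω = ≡.cong ℕ.suc (bits-pull (t _) a b ω)
      bits-pull (bob m t)   a b ω = ≡.cong ℕ.suc (bits-pull (t _) a b ω)

      answer-pull : ∀ t a b ω → answer (pull t) a b ω ≡ α * answer t φ⟨ a ⟩ ψ⟨ b ⟩ ω
      answer-pull (output r)  a b ω = ≡.refl
      answer-pull (alice m t) a b ω = answer-pull (t _) a b ω
      answer-pull (bob m t)   a b ω = answer-pull (t _) a b ω

      oneWay-pull : ∀ t → IsOneWay t → IsOneWay (pull t)
      oneWay-pull (output r)  _       = tt
      oneWay-pull (alice m t) one-way = λ β → oneWay-pull (t β) (one-way β)

    pullProtocol : Protocol A′ B′ → Protocol A B
    pullProtocol Π = record { coins = coins ; tree = pull tree }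
      where open Protocol Π

    -- The longest run may be lost in passing to the images of φ and ψ, so the
    -- cost can drop.
    cost-pull : ∀ Π {c} → HasCost Π c → Setoid.Carrier A → Setoid.Carrier B →
                ∃[ c′ ] (c′ ℕ.≤ c × HasCost (pullProtocol Π) c′)
    cost-pull Π {c} (bound , _ , _ , ω , _) a b =
      let m , m≤c , upper , (a′ , b′ , ω′) , eq = max-attained em
            (λ (a , b , ω) → bits (pull tree) a b ω) (a , b , ω) c
            (λ (a , b , ω) → ≡.subst (ℕ._≤ c) (≡.sym (bits-pull tree a b ω)) (bound _ _ ω))
      in  m , m≤c , (λ a b ω → upper (a , b , ω)) , a′ , b′ , ω′ , eq
      where open Protocol Π

  module _ {k n} (X : Norm k) (Y : Norm n)
           (φ : Func (Ball X) (Ball Y)) (ψ : Func (DualBall X) (DualBall Y))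
           {α : R} (0<α : 0# < α)
           (pairing : ∀ v w → α * ⟨ proj₁ (Func.to φ v) , proj₁ (Func.to ψ w) ⟩ ≈ ⟨ proj₁ v , proj₁ w ⟩)
           (ε δ : R) where

    -- Answer and inner product both scale by `α`, hence so does the error. Error at most `ε` for
    -- the new protocol and at most `α ⁻¹ * ε` for `Π` are the same event of the same coins.
    solves-pull : ∀ Π → SolvesIP Y (α ⁻¹ * ε) δ Π → SolvesIP X ε δ (pullProtocol φ ψ 0<α Π)
    solves-pull Π solves v w = ≤-respʳ-≈
      (ℙ-cong ( (λ {ω} → ≤-respˡ-≈ (sym (error ω)) ∘ Equivalence.from (*-≤⇔≤-⁻¹* 0<α))
              , (λ {ω} → Equivalence.to (*-≤⇔≤-⁻¹* 0<α) ∘ ≤-respˡ-≈ (error ω)) ))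
      (solves (Func.to φ v) (Func.to ψ w))
      where
      open Protocol Π
      open ProbabilitySpace (PrivateCoins.joint coins)

      error : ∀ ω →
        ∣ answer (pull φ ψ 0<α tree) v w ω - ⟨ proj₁ v , proj₁ w ⟩ ∣ ≈
        α * ∣ answer tree (Func.to φ v) (Func.to ψ w) ω - ⟨ proj₁ (Func.to φ v) , proj₁ (Func.to ψ w) ⟩ ∣
      error ω = trans
        (∣∣-cong (trans (+-cong (reflexive (answer-pull φ ψ 0<α tree v w ω)) (-‿cong (sym (pairing v w))))
          (sym (x[y-z]≈xy-xz α _ _))))
        (∣ax∣≈a∣x∣ (proj₁ 0<α) _)

    open Complexity em

    ℛ-pull : ℛ ε δ X ≤⁺ ℛ (α ⁻¹ * ε) δ Y
    ℛ-pull = minimum-mono em λ { c (Π , solves , cost) →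
      -- The zero vectors provide inputs from which `cost-pull` can start its search for the longest
      -- run.
      let c′ , c′≤c , cost′ = cost-pull φ ψ 0<α Π cost (0∈Ball X) (0∈DualBall X)
      in  c′ , c′≤c , pullProtocol φ ψ 0<α Π , solves-pull Π solves , cost′ }

    ℛ→-pull : ℛ→ ε δ X ≤⁺ ℛ→ (α ⁻¹ * ε) δ Y
    ℛ→-pull = minimum-mono em λ { c (Π , one-way , solves , cost) →
      let c′ , c′≤c , cost′ = cost-pull φ ψ 0<α Π cost (0∈Ball X) (0∈DualBall X)
      in  c′ , c′≤c , pullProtocol φ ψ 0<α Π
          , oneWay-pull φ ψ 0<α (Protocol.tree Π) one-way , solves-pull Π solves , cost′ }

proposition3p1 : (em : ExcludedMiddle (suc 0ℓ)) (ℝ : CompleteOrderedField) →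
    let open CompleteOrderedField ℝ
        open Spaces ℝ
        open Communication ℝ
        open Complexity em
    in ∀ {k n} (X : Norm k) (Y : Norm n) (α : Carrier) → 0# < α → Embeds X Y α →
       ∀ (ε δ : Carrier) →
       (ℛ ε δ X ≤⁺ ℛ (α ⁻¹ * ε) δ Y) × (ℛ→ ε δ X ≤⁺ ℛ→ (α ⁻¹ * ε) δ Y)
proposition3p1 em ℝ X Y α 0<α X↪Y ε δ =
    ℛ-pull X Y φ ψ 0<α pairing ε δ , ℛ→-pull X Y φ ψ 0<α pairing ε δ
  where
  open Adjoint em ℝ
  open Pullback em ℝ
  φ       = embedBall X Y 0<α X↪Y
  ψ       = extendDual X Y 0<α X↪Y
  pairing = extendDual-pairing X Y 0<α X↪Y
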